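{- Let $\sigma=\sigma_1\cdots\sigma_k$ be a permutation of length $k\ge 3$. The following three conditions are equivalent. (1) $\mathrm{Sort}(\sigma)\not\subseteq\mathrm{Sym}(\xi)$. (2) $\sigma=12\ominus\beta$ for some $\beta\in\mathrm{Sym}(231)$. (3) $\hat{\sigma}\in\mathrm{Sym}(231)$ and $\sigma^{\mathsf{R}}$ contains $\xi$.
   Context: $\mathrm{Sym}_n$ is the set of permutations of $\{1,\dots,n\}$ in one-line notation and $\mathrm{Sym}=\bigcup_{n\ge 1}\mathrm{Sym}_n$. A sequence of distinct numbers contains a permutation $\tau$ of length $k$ if it has a (not necessarily contiguous) subsequence of length $k$ that is order isomorphic to $\tau$ (such a subsequence is an occurrence of $\tau$); otherwise it avoids $\tau$. $\mathrm{Sym}(\tau)$ denotes the set of permutations in $\mathrm{Sym}$ avoiding $\tau$. Bivincular pattern $\xi=(132,\{0,2\},\emptyset)$: a permutation $\pi=\pi_1\cdots\pi_n$ contains $\xi$ if there is an index $j\ge 2$ with $j+1\le n$ such that $\pi_1<\pi_{j+1}<\pi_j$ (that is, $\pi_1\pi_j\pi_{j+1}$ is an occurrence of $132$ that starts at the first entry of $\pi$ and whose last two entries are adjacent in position); otherwise $\pi$ avoids $\xi$. $\mathrm{Sym}(\xi)$ is the set of permutations avoiding $\xi$. For $\sigma=\sigma_1\sigma_2\sigma_3\cdots\sigma_k$: $\hat\sigma=\sigma_2\sigma_1\sigma_3\cdots\sigma_k$ (interchange the first two entries) and $\sigma^{\mathsf{R}}=\sigma_k\cdots\sigma_1$. The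 skew sum $\alpha\ominus\beta$ of permutations $\alpha$ (of length $n$) and $\beta$ (of length $m$) is the permutation $\gamma_1\cdots\gamma_{n+m}$ such that $\gamma_1\cdots\gamma_n$ is order isomorphic to $\alpha$, $\gamma_{n+1}\cdots\gamma_{n+m}$ is order isomorphic to $\beta$, and $\gamma_i>\gamma_j$ whenever $i\le n<j$. For a permutation $\tau$ of length at least two, the $\tau$-stack operator $\mathcal{S}^{\tau}:\mathrm{Sym}\to\mathrm{Sym}$ sends $\pi$ to the output of the following greedy process, starting with an empty stack and an empty output. While there are unread entries of $\pi$ (read from left to right): if pushing the next entry on top of the stack yields stack content that, read from top to bottom, avoids $\tau$, push it; otherwise pop the top entry of the stack and append it to the right end of the output. When all entries of $\pi$ have been read, pop all remaining entries of the stack one by one, appending them to the output. A permutation $\pi\in\mathrm{Sym}_n$ is $\sigma$-sortable if $(\mathcal{S}^{21}\circ\mathcal{S}^{\sigma})(\pi)=12\cdots n$; $\mathrm{Sort}(\sigma)$ is the set of $\sigma$-sortable permutations. -}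

module Defs where

open import Data.Bool using (true; false; if_then_else_)
open import Data.Fin using (cast)
open import Data.Fin.Properties using (all?)
open import Data.List using (List; []; _∷_; _++_; length; lookup; map; upTo)
open import Data.List.Membership.Propositional using (_∈_)
open import Data.List.Properties using (++-identityʳ)
open import Data.List.Relation.Binary.Permutation.Propositional
  using (_↭_; ↭-refl; ↭-reflexive; ↭-sym; ↭-trans; prep)
open import Data.List.Relation.Binary.Permutation.Propositional.Properties using (shift)
open import Data.List.Relation.Binary.Sublist.Propositional using (_⊆_; []; _∷_; _∷ʳ_)
open import Data.Nat using (ℕ; suc; _<_; _≤_; _≟_; _<?_)
open import Data.Product using (∃-syntax; Σ-syntax; _×_; _,_)
open import Function using (_⇔_; mk⇔; Equivalence)
open import Level using (0ℓ)
open import Relation.Binary.PropositionalEquality using (_≡_; refl)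
open import Relation.Nullary using (¬_; Dec; yes; no; does; ¬?)
open import Relation.Nullary.Decidable using (map′; _×-dec_; _→-dec_)
open import Relation.Unary using (Pred; Decidable; _∩_)

oneTo : ℕ → List ℕ
oneTo n = map suc (upTo n)

Symₙ : ℕ → Pred (List ℕ) 0ℓ
Symₙ n π = π ↭ oneTo n

Sym : Pred (List ℕ) 0ℓ
Sym π = ∃[ n ] 1 ≤ n × Symₙ n π

infix 4 _≅_ _≅?_

_≅_ : List ℕ → List ℕ → Set
xs ≅ ys = Σ[ eq ∈ length xs ≡ length ys ]
  (∀ i j → lookup xs i < lookup xs j ⇔ lookup ys (cast eq i) < lookup ys (cast eq j))

Contains : List ℕ → List ℕ → Set
Contains τ xs = ∃[ ys ] ys ⊆ xs × ys ≅ τ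

Avoids : List ℕ → List ℕ → Set
Avoids τ xs = ¬ Contains τ xs

Sym⟨_⟩ : List ℕ → Pred (List ℕ) 0ℓ
Sym⟨ τ ⟩ = Sym ∩ Avoids τ

-- The bivincular pattern ξ = (132, {0,2}, ∅): the witnesses a, c, b are the
-- entries π₁, πⱼ, πⱼ₊₁, where j ≥ 2 is the position of c.

Containsξ : Pred (List ℕ) 0ℓ
Containsξ π = ∃[ a ] ∃[ u ] ∃[ c ] ∃[ b ] ∃[ v ]
  π ≡ a ∷ u ++ c ∷ b ∷ v × a < b × b < c

Symξ : Pred (List ℕ) 0ℓ
Symξ π = Sym π × ¬ Containsξ π

-- The second clause is a junk value: σ̂ needs length at least two.

hat : List ℕ → List ℕ
hat (x ∷ y ∷ xs) = y ∷ x ∷ xs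
hat xs           = xs

-- IsSkewSum α β γ means γ = α ⊖ β; the conditions determine the permutation γ.

IsSkewSum : List ℕ → List ℕ → List ℕ → Set
IsSkewSum α β γ = Sym γ × (∃[ γ₁ ] ∃[ γ₂ ]
  γ ≡ γ₁ ++ γ₂ × γ₁ ≅ α × γ₂ ≅ β × (∀ {x y} → x ∈ γ₁ → y ∈ γ₂ → y < x))

_≅?_ : ∀ xs ys → Dec (xs ≅ ys)
xs ≅? ys with length xs ≟ length ys
... | no ≢  = no λ (eq , _) → ≢ eq
... | yes eq = map′ (eq ,_) (λ (_ , f) → f)
  (all? λ i → all? λ j → iff? (lookup xs i <? lookup xs j)
                              (lookup ys (cast eq i) <? lookup ys (cast eq j)))
  where
  iff? : {A B : Set} → Dec A → Dec B → Dec (A ⇔ B)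
  iff? a? b? = map′ (λ (f , g) → mk⇔ f g)
                    (λ e → Equivalence.to e , Equivalence.from e)
                    ((a? →-dec b?) ×-dec (b? →-dec a?))

anySublist? : {P : Pred (List ℕ) 0ℓ} → Decidable P → ∀ xs → Dec (∃[ ys ] ys ⊆ xs × P ys)
anySublist? P? [] = map′ (λ p → [] , [] , p) (λ { (_ , [] , p) → p }) (P? [])
anySublist? P? (x ∷ xs) with anySublist? P? xs | anySublist? (λ ys → P? (x ∷ ys)) xs
... | yes (ys , s , p) | _                = yes (ys , x ∷ʳ s , p)
... | no _             | yes (ys , s , p) = yes (x ∷ ys , refl ∷ s , p)
... | no ¬drop         | no ¬keep         = no λ
  { (ys , _ ∷ʳ s , p)       → ¬drop (ys , s , p)
  ; (_ ∷ ys , refl ∷ s , p) → ¬keep (ys , s , p)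
  }

avoids? : ∀ τ xs → Dec (Avoids τ xs)
avoids? τ xs = ¬? (anySublist? (_≅? τ) xs)

-- stack τ input s is the output of the greedy process still to come when
-- input is unread and s, listed from top to bottom, is the stack content.
-- Pushing onto the empty stack needs no test, since τ has length at least two.

stack : List ℕ → List ℕ → List ℕ → List ℕ
stack τ []       s       = s
stack τ (x ∷ xs) []      = stack τ xs (x ∷ [])
stack τ (x ∷ xs) (t ∷ s) =
  if does (avoids? τ (x ∷ t ∷ s))
  then stack τ xs (x ∷ t ∷ s)
  else t ∷ stack τ (x ∷ xs) s

𝒮 : List ℕ → List ℕ → List ℕ
𝒮 τ π = stack τ π []

stack-↭ : ∀ τ xs s → stack τ xs s ↭ xs ++ s
stack-↭ τ []       s  = ↭-refl
stack-↭ τ (x ∷ xs) [] = ↭-trans (stack-↭ τ xs (x ∷ [])) (shift x xs [])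
stack-↭ τ (x ∷ xs) (t ∷ s) = if-elim (does (avoids? τ (x ∷ t ∷ s)))
  (↭-trans (stack-↭ τ xs (x ∷ t ∷ s)) (shift x xs (t ∷ s)))
  (↭-trans (prep t (stack-↭ τ (x ∷ xs) s)) (↭-sym (shift t (x ∷ xs) s)))
  where
  if-elim : ∀ b {us vs ws : List ℕ} → us ↭ ws → vs ↭ ws → (if b then us else vs) ↭ ws
  if-elim true  p q = p
  if-elim false p q = q

𝒮-Symₙ : ∀ τ {n π} → Symₙ n π → Symₙ n (𝒮 τ π)
𝒮-Symₙ τ {π = π} p = ↭-trans (stack-↭ τ π []) (↭-trans (↭-reflexive (++-identityʳ π)) p)

Sort : List ℕ → Pred (List ℕ) 0ℓ
Sort σ π = ∃[ n ] 1 ≤ n × Symₙ n π × 𝒮 (2 ∷ 1 ∷ []) (𝒮 σ π) ≡ oneTo n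

{-# OPTIONS --safe #-}
module Submission where

-- All three conditions say that σ = p q r with p < q, every entry of r below p,
-- and r avoiding 231.
--
-- If σ has this shape, then π = σᴿ contains ξ, and pushing its last entry p
-- pops exactly q, so that 𝒮 σ π = σ̂, which avoids 231 and is sorted by 𝒮 21.
--
-- Conversely let π = a … c b … be σ-sortable with a < b < c, so 𝒮 σ π avoids 231.
-- The first entry a stays at the bottom of the stack, and whatever is on the stack
-- at one time leaves it from top to bottom.  So c is popped before b is pushed (or
-- else b c a is output), and after the push all entries of the stack below b are
-- smaller than b (or else b y a is output).  Let t be the last entry popped before
-- b is pushed.  This pop is due to an occurrence b t r of σ, where r < b.
-- If t < b, then c t r would be an occurrence of σ that was already on the stack.
-- Hence t > b, and r avoids 231 because it is a subsequence of the output.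

open import Defs
open import Data.Bool using (if_then_else_)
open import Data.Empty using (⊥-elim)
open import Data.Fin using (zero; suc; cast)
open import Data.List using (List; []; _∷_; _++_; _ʳ++_; length; lookup; map; upTo; reverse)
open import Data.List.Membership.Propositional using () renaming (_∈_ to _∈ˡ_)
open import Data.List.Membership.Propositional.Properties
  using (∈-++⁺ˡ; ∈-++⁻; ∈-map⁻; ∈-upTo⁻)
open import Data.List.Properties
  using (map-++; ∷-injectiveʳ; upTo-∷ʳ; ++-identityʳ; ++-assoc; ʳ++-defn; reverse-involutive;
         reverse-++; unfold-reverse; length-reverse)
open import Data.List.Relation.Binary.Permutation.Propositional
  using (_↭_; ↭-sym; ↭-trans; ↭-reflexive; swap; ↭-refl; ↭⇒↭ₛ)
open import Data.List.Relation.Binary.Permutation.Propositional.Properties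
  using (∈-resp-↭; All-resp-↭; drop-∷; ∷↭∷ʳ; ↭-reverse; ↭-length)
import Data.List.Relation.Binary.Permutation.Setoid.Properties as ↭ₛ
open import Data.List.Relation.Binary.Pointwise as Pointwise
  using (Pointwise; []; _∷_; Pointwise-≡⇒≡)
open import Data.List.Relation.Binary.Sublist.Propositional
  using (_⊆_; []; _∷_; _∷ʳ_; ⊆-refl; ⊆-trans; to∈; from∈; minimum)
open import Data.List.Relation.Binary.Sublist.Propositional.Properties
  using (All-resp-⊆; length-mono-≤; ++⁺ˡ; ++⁺; ∷ˡ⁻)
open import Data.List.Relation.Unary.All as All using (All; []; _∷_)
open import Data.List.Relation.Unary.AllPairs as AllPairs using (AllPairs; []; _∷_)
import Data.List.Relation.Unary.AllPairs.Properties as AllPairs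
open import Data.List.Relation.Unary.Any using (here; there)
open import Data.List.Relation.Unary.Sorted.TotalOrder.Properties using (AllPairs⇒Sorted; ↗↭↗⇒≋)
open import Data.List.Relation.Unary.Unique.Propositional using (Unique)
open import Data.Nat using (ℕ; suc; _+_; _≥_; _≤_; _<_; z≤n; s≤s; z<s; s<s; _<?_)
open import Data.Nat.Properties
open import Data.Product using (∃-syntax; _×_; _,_; proj₁; proj₂)
open import Data.Sum using (_⊎_; inj₁; inj₂)
open import Function using (_⇔_; mk⇔; Equivalence; _∘_)
open import Relation.Binary.Definitions using (Tri; tri<; tri≈; tri>)
open import Relation.Binary.PropositionalEquality
  using (_≡_; refl; sym; trans; cong; cong₂; subst; module ≡-Reasoning; setoid)
open import Relation.Nullary using (¬_; ¬?; Dec; does; yes; no; contradiction)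
open import Relation.Nullary.Decidable using (_×-dec_; decidable-stable; dec-true; dec-false)
open import Relation.Unary using (_∈_; _⊈_)

open Equivalence using (to; from)

private variable
  a b c p q t x y z n : ℕ
  o r s u v w xs ys zs β σ τ : List ℕ

p21 p231 : List ℕ
p21 = 2 ∷ 1 ∷ []
p231 = 2 ∷ 3 ∷ 1 ∷ []

-- Order isomorphism

SameOrder : ℕ → ℕ → ℕ → ℕ → Set
SameOrder x y u v = (x < u ⇔ y < v) × (u < x ⇔ v < y)

infix 4 _≃_

-- Comparing each entry with the later ones only avoids the index casts of _≅_.
data _≃_ : List ℕ → List ℕ → Set where
  []  : [] ≃ []
  _∷_ : Pointwise (SameOrder x y) xs ys → xs ≃ ys → x ∷ xs ≃ y ∷ ys

pointwise-lookup : {R : ℕ → ℕ → Set} (eq : length xs ≡ length ys) →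
  (∀ i → R (lookup xs i) (lookup ys (cast eq i))) → Pointwise R xs ys
pointwise-lookup {[]}    {[]}    _  _ = []
pointwise-lookup {_ ∷ _} {_ ∷ _} eq f =
  f zero ∷ pointwise-lookup (suc-injective eq) (f ∘ suc)

lookup-pointwise : {R : ℕ → ℕ → Set} (eq : length xs ≡ length ys) →
  Pointwise R xs ys → ∀ i → R (lookup xs i) (lookup ys (cast eq i))
lookup-pointwise eq (Rxy ∷ _)   zero    = Rxy
lookup-pointwise eq (_   ∷ Rxs) (suc i) = lookup-pointwise (suc-injective eq) Rxs i

≅⇒≃ : xs ≅ ys → xs ≃ ys
≅⇒≃ {[]}    {[]}    _        = []
≅⇒≃ {_ ∷ _} {_ ∷ _} (eq , f) =
  pointwise-lookup (suc-injective eq) (λ i → f zero (suc i) , f (suc i) zero)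
  ∷ ≅⇒≃ (suc-injective eq , λ i j → f (suc i) (suc j))

≃-length : xs ≃ ys → length xs ≡ length ys
≃-length []        = refl
≃-length (_ ∷ iso) = cong suc (≃-length iso)

≃⇒≅ : xs ≃ ys → xs ≅ ys
≃⇒≅ iso = ≃-length iso , compare (≃-length iso) iso
  where
  compare : (eq : length xs ≡ length ys) → xs ≃ ys → ∀ i j →
    lookup xs i < lookup xs j ⇔ lookup ys (cast eq i) < lookup ys (cast eq j)
  compare eq (_ ∷ _)   zero    zero    = mk⇔ (λ lt → contradiction lt (n≮n _)) (λ lt → contradiction lt (n≮n _))
  compare eq (R ∷ _)   zero    (suc j) = proj₁ (lookup-pointwise (suc-injective eq) R j)
  compare eq (R ∷ _)   (suc i) zero    = proj₂ (lookup-pointwise (suc-injective eq) R i)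
  compare eq (_ ∷ iso) (suc i) (suc j) = compare (suc-injective eq) iso i j

≃-refl : xs ≃ xs
≃-refl {[]}    = []
≃-refl {_ ∷ _} = Pointwise.refl (mk⇔ (λ lt → lt) (λ lt → lt) , mk⇔ (λ lt → lt) (λ lt → lt)) ∷ ≃-refl

≃-sym : xs ≃ ys → ys ≃ xs
≃-sym []        = []
≃-sym (R ∷ iso) =
  Pointwise.symmetric (λ (f , g) → mk⇔ (from f) (to f) , mk⇔ (from g) (to g)) R ∷ ≃-sym iso

≃-⊆ : ys ⊆ xs → xs ≃ zs → ∃[ ws ] ws ⊆ zs × ys ≃ ws
≃-⊆ s iso with transport s iso
  where
  -- The last component passes comparisons of any outer entry with `xs` on to the sublist; each kept
  -- head needs this for its own comparisons.
  transport : ys ⊆ xs → xs ≃ zs → ∃[ ws ] ws ⊆ zs × ys ≃ ws ×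
    (∀ {x y} → Pointwise (SameOrder x y) xs zs → Pointwise (SameOrder x y) ys ws)
  transport []         []        = [] , [] , [] , λ R → R
  transport (_ ∷ʳ s)   (_ ∷ iso) with transport s iso
  ... | ws , s′ , iso′ , pick = ws , _ ∷ʳ s′ , iso′ , λ { (_ ∷ Rs) → pick Rs }
  transport (refl ∷ s) (R ∷ iso) with transport s iso
  ... | ws , s′ , iso′ , pick =
    _ ∷ ws , refl ∷ s′ , pick R ∷ iso′ , λ { (Rx ∷ Rs) → Rx ∷ pick Rs }
... | ws , s′ , iso′ , _ = ws , s′ , iso′

-- The head stays the largest entry, so no comparison with it changes. This lets c replace b in an
-- occurrence of the pattern.
raise-max : All (_< b) xs → b < c → b ∷ xs ≃ ys → c ∷ xs ≃ ys
raise-max small b<c (R ∷ iso) = raise small R ∷ iso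
  where
  raise : All (_< _) xs → Pointwise (SameOrder _ y) xs ys → Pointwise (SameOrder _ y) xs ys
  raise []           []            = []
  raise (z<b ∷ small) ((f , g) ∷ R) =
    ( mk⇔ (λ c<z → contradiction (<-trans z<b b<c) (<-asym c<z))
          (λ y<w → contradiction (from f y<w) (<-asym z<b))
    , mk⇔ (λ _ → to g z<b) (λ _ → <-trans z<b b<c)) ∷ raise small R

-- Pattern containment

avoids-⊆ : ys ⊆ xs → Avoids τ xs → Avoids τ ys
avoids-⊆ s av (zs , s′ , iso) = av (zs , ⊆-trans s′ s , iso)

contains-self : Contains τ τ
contains-self {τ} = τ , ⊆-refl , ≃⇒≅ (≃-refl {τ})

avoids-short : length xs < length τ → Avoids τ xs
avoids-short short (ys , s , eq , _) = <⇒≱ short (subst (_≤ _) eq (length-mono-≤ s))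

≅12⇒< : xs ≅ 1 ∷ 2 ∷ [] → ∃[ a ] ∃[ b ] xs ≡ a ∷ b ∷ [] × a < b
≅12⇒< {a ∷ b ∷ []} (_ , f) = a , b , refl , from (f zero (suc zero)) (s<s z<s)

<⇒≅12 : a < b → a ∷ b ∷ [] ≅ 1 ∷ 2 ∷ []
<⇒≅12 a<b = ≃⇒≅ (((mk⇔ (λ _ → s<s z<s) (λ _ → a<b)
                 , mk⇔ (λ b<a → contradiction a<b (<-asym b<a)) (λ { (s≤s ()) })) ∷ []) ∷ [] ∷ [])

contains-21⁻ : Contains p21 xs → ∃[ b ] ∃[ a ] b ∷ a ∷ [] ⊆ xs × a < b
contains-21⁻ (b ∷ a ∷ [] , s , _ , f) = b , a , s , from (f (suc zero) zero) (s<s z<s)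

contains-21⁺ : b ∷ a ∷ [] ⊆ xs → a < b → Contains p21 xs
contains-21⁺ s a<b = _ , s , ≃⇒≅
  (((mk⇔ (λ b<a → contradiction a<b (<-asym b<a)) (λ { (s≤s ()) })
   , mk⇔ (λ _ → s<s z<s) (λ _ → a<b)) ∷ []) ∷ [] ∷ [])

contains-231⁻ : Contains p231 xs → ∃[ b ] ∃[ c ] ∃[ a ] b ∷ c ∷ a ∷ [] ⊆ xs × a < b × b < c
contains-231⁻ (b ∷ c ∷ a ∷ [] , s , _ , f) =
  b , c , a , s , from (f (suc (suc zero)) zero) (s<s z<s) , from (f zero (suc zero)) (s<s (s<s z<s))

contains-231⁺ : b ∷ c ∷ a ∷ [] ⊆ xs → a < b → b < c → Contains p231 xs
contains-231⁺ s a<b b<c = _ , s , ≃⇒≅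
  ( ((mk⇔ (λ _ → s<s (s<s z<s)) (λ _ → b<c)
     , mk⇔ (λ c<b → contradiction b<c (<-asym c<b)) (λ { (s≤s (s≤s ())) }))
    ∷ (mk⇔ (λ b<a → contradiction a<b (<-asym b<a)) (λ { (s≤s ()) })
     , mk⇔ (λ _ → s<s z<s) (λ _ → a<b)) ∷ [])
  ∷ ((mk⇔ (λ c<a → contradiction (<-trans a<b b<c) (<-asym c<a)) (λ { (s≤s ()) })
     , mk⇔ (λ _ → s<s z<s) (λ _ → <-trans a<b b<c)) ∷ [])
  ∷ [] ∷ [])

contains-231-≃ : xs ≃ ys → Contains p231 xs → Contains p231 ys
contains-231-≃ iso con with contains-231⁻ con
... | b , c , a , s , a<b , b<c with ≃-⊆ s iso
... | _ ∷ _ ∷ _ ∷ [] , s′ , ((bc , _) ∷ (_ , ba) ∷ []) ∷ _ =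
  contains-231⁺ s′ (to ba a<b) (to bc b<c)

-- A front entry could only play the 2 of 231, and then a larger entry would have to follow.
avoids-231-max∷ : All (_< x) xs → Avoids p231 xs → Avoids p231 (x ∷ xs)
avoids-231-max∷ max av con with contains-231⁻ con
... | _ , _ , _ , _ ∷ʳ s   , a<b , b<c = av (contains-231⁺ s a<b b<c)
... | _ , _ , _ , refl ∷ s , a<b , b<c = <-asym b<c (All.lookup max (to∈ s))

-- Increasing lists and permutations of 1, ..., n

allPairs-⊆ : {R : ℕ → ℕ → Set} → AllPairs R xs → a ∷ b ∷ [] ⊆ xs → R a b
allPairs-⊆ (_ ∷ Rs) (_ ∷ʳ s)   = allPairs-⊆ Rs s
allPairs-⊆ (R ∷ _)  (refl ∷ s) = All.lookup R (to∈ s)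

oneTo-increasing : ∀ n → AllPairs _<_ (oneTo n)
oneTo-increasing n = AllPairs.map⁺ (AllPairs.applyUpTo⁺₁ (λ i → i) n λ i<j _ → s<s i<j)

∈-oneTo⁻ : x ∈ˡ oneTo n → x ≤ n
∈-oneTo⁻ x∈ with ∈-map⁻ suc x∈
... | _ , i∈ , refl = ∈-upTo⁻ i∈

symₙ-unique : xs ∈ Symₙ n → Unique xs
symₙ-unique {n = n} p = ↭ₛ.Unique-resp-↭ (setoid ℕ) (↭⇒↭ₛ (↭-sym p))
  (AllPairs.map <⇒≢ (oneTo-increasing n))

oneTo-suc : ∀ n → suc n ∷ oneTo n ↭ oneTo (suc n)
oneTo-suc n = ↭-trans (∷↭∷ʳ (suc n) (oneTo n)) (↭-reflexive
  (trans (sym (map-++ suc (upTo n) (n ∷ []))) (cong (map suc) (upTo-∷ʳ n))))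

symₙ-drop-max : All (_< x) xs → x ∷ xs ∈ Symₙ (suc n) → xs ∈ Symₙ n
symₙ-drop-max {x} {xs} {n} max p = drop-∷ (↭-trans (subst (λ m → m ∷ xs ↭ oneTo (suc n)) x≡ p)
                                       (↭-sym (oneTo-suc n)))
  where
  x≤ : x ≤ suc n
  x≤ = ∈-oneTo⁻ (∈-resp-↭ p (here refl))
  ≤x : suc n ≤ x
  ≤x with ∈-resp-↭ (↭-sym p) (∈-resp-↭ (oneTo-suc n) (here refl))
  ... | here eq  = ≤-reflexive eq
  ... | there m∈ = <⇒≤ (All.lookup max m∈)
  x≡ : x ≡ suc n
  x≡ = ≤-antisym x≤ ≤x

sorted-symₙ : AllPairs _≤_ xs → xs ∈ Symₙ n → xs ≡ oneTo n
sorted-symₙ {n = n} sorted p = Pointwise-≡⇒≡ (↗↭↗⇒≋ ≤-totalOrder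
  (AllPairs⇒Sorted ≤-totalOrder sorted)
  (AllPairs⇒Sorted ≤-totalOrder (AllPairs.map <⇒≤ (oneTo-increasing n)))
  (↭⇒↭ₛ p))

-- Runs of the stack operator

-- Each step carries the outcome of its test, so that proofs can recurse on the run of the greedy
-- process.
data Run (τ : List ℕ) : List ℕ → List ℕ → List ℕ → Set where
  done  : Run τ [] s s
  start : Run τ xs (x ∷ []) o → Run τ (x ∷ xs) [] o
  push  : Avoids τ (x ∷ t ∷ s) → Run τ xs (x ∷ t ∷ s) o → Run τ (x ∷ xs) (t ∷ s) o
  pop   : Contains τ (x ∷ t ∷ s) → Run τ (x ∷ xs) s o → Run τ (x ∷ xs) (t ∷ s) (t ∷ o)

run : ∀ τ xs s → Run τ xs s (stack τ xs s)
run τ []       s       = done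
run τ (x ∷ xs) []      = start (run τ xs (x ∷ []))
run τ (x ∷ xs) (t ∷ s) =
  -- A `pop` carries an actual occurrence, so the choice is made on the search underlying `avoids?`.
  choose (anySublist? (_≅? τ) (x ∷ t ∷ s)) (run τ xs (x ∷ t ∷ s)) (run τ (x ∷ xs) s)
  where
  choose : (con? : Dec (Contains τ (x ∷ t ∷ s))) → Run τ xs (x ∷ t ∷ s) u → Run τ (x ∷ xs) s v →
    Run τ (x ∷ xs) (t ∷ s) (if does (¬? con?) then u else t ∷ v)
  choose (yes con) _ r = pop con r
  choose (no av)   r _ = push av r

run-unique : Run τ xs s o → stack τ xs s ≡ o
run-unique done      = refl
run-unique (start r) = run-unique r
run-unique {τ} (push {x = x} {t} {s} av r)
  rewrite dec-true (avoids? τ (x ∷ t ∷ s)) av = run-unique r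
run-unique {τ} (pop {x = x} {t} {s} con r)
  rewrite dec-false (avoids? τ (x ∷ t ∷ s)) (λ av → av con) = cong (t ∷_) (run-unique r)

-- Later entries are pushed on top of the present content, which thus keeps its order on its way to
-- the output.
run-⊇ : Run τ xs s o → s ⊆ o
run-⊇ done       = ⊆-refl
run-⊇ (start _)  = minimum _
run-⊇ (push _ r) = ∷ˡ⁻ (run-⊇ r)
run-⊇ (pop _ r)  = refl ∷ run-⊇ r

run-↭ : Run τ xs s o → o ↭ xs ++ s
run-↭ {τ} {xs} {s} r = subst (_↭ xs ++ s) (run-unique r) (stack-↭ τ xs s)

-- Every content met while pushing `xs` is shorter than the pattern, so no pop is forced; the stack
-- ends as `xs ʳ++ s`.
run-load : length xs + length s < length τ → Run τ zs (xs ʳ++ s) o → Run τ (xs ++ zs) s o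
run-load {[]}             _     r = r
run-load {_ ∷ xs} {[]}    short r = start (run-load (≤-<-trans (≤-reflexive (+-suc (length xs) 0)) short) r)
run-load {_ ∷ xs} {_ ∷ s} {τ} short r =
  push (avoids-short {τ = τ} (≤-<-trans (s≤s (m≤n+m _ (length xs))) short))
       (run-load (≤-<-trans (≤-reflexive (+-suc (length xs) _)) short) r)

-- Sorting with a 21-stack

-- Pushing the larger c above b would create 21, so b leaves the stack while a is still unread.
stack21-pops : Run p21 xs s o → b ∈ˡ s → c ∷ a ∷ [] ⊆ xs → b < c → b ∷ a ∷ [] ⊆ o
stack21-pops (push av r) b∈ (refl ∷ _) b<c = ⊥-elim (av (contains-21⁺ (refl ∷ from∈ b∈) b<c))
stack21-pops (push av r) b∈ (_ ∷ʳ ca)  b<c = stack21-pops r (there b∈) ca b<c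
stack21-pops (pop _ r) (there b∈)  ca b<c = _ ∷ʳ stack21-pops r b∈ ca b<c
stack21-pops (pop _ r) (here refl) ca b<c =
  refl ∷ from∈ (∈-resp-↭ (↭-sym (run-↭ r)) (∈-++⁺ˡ (to∈ (∷ˡ⁻ ca))))

stack21-inverts : Run p21 xs s o → b ∷ c ∷ a ∷ [] ⊆ xs → b < c → b ∷ a ∷ [] ⊆ o
stack21-inverts (start r)  (refl ∷ ca) = stack21-pops r (here refl) ca
stack21-inverts (start r)  (_ ∷ʳ bca)  = stack21-inverts r bca
stack21-inverts (push _ r) (refl ∷ ca) = stack21-pops r (here refl) ca
stack21-inverts (push _ r) (_ ∷ʳ bca)  = stack21-inverts r bca
stack21-inverts (pop _ r)  bca b<c     = _ ∷ʳ stack21-inverts r bca b<c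

-- Invariant: the stack increases from top to bottom, and no stack entry followed by the unread ones
-- contains 231. A popped t gives way to a larger x, so an unread y below t would make t x y an
-- occurrence of 231; hence t is at most everything output later.
stack21-sorts : Run p21 xs s o → AllPairs _≤_ s → Avoids p231 xs →
  All (λ t → Avoids p231 (t ∷ xs)) s → AllPairs _≤_ o
stack21-sorts done sorted _ _ = sorted
stack21-sorts (start r) _ av _ =
  stack21-sorts r ([] ∷ []) (avoids-⊆ (_ ∷ʳ ⊆-refl) av) (av ∷ [])
stack21-sorts (push {x = x} {t} noInv r) (t≤s ∷ sorted) av avs =
  stack21-sorts r ((x≤t ∷ All.map (≤-trans x≤t) t≤s) ∷ t≤s ∷ sorted) (avoids-⊆ (_ ∷ʳ ⊆-refl) av)
    (av ∷ All.map (avoids-⊆ (refl ∷ _ ∷ʳ ⊆-refl)) avs)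
  where
  x≤t : x ≤ t
  x≤t = ≮⇒≥ (noInv ∘ contains-21⁺ (refl ∷ refl ∷ minimum _))
stack21-sorts (pop {x = x} {t} {s} {xs = xs} inv r) (t≤s ∷ sorted) av (avt ∷ avs) =
  All-resp-↭ (↭-sym (run-↭ r)) (All.tabulate t≤) ∷ stack21-sorts r sorted av avs
  where
  -- As the stack is sorted, the inversion starts with x, and its smaller entry is at least t.
  t<x : t < x
  t<x with contains-21⁻ inv
  ... | _ , _ , _ ∷ʳ s′ , lt = contradiction lt (≤⇒≯ (allPairs-⊆ (t≤s ∷ sorted) s′))
  ... | _ , _ , refl ∷ s′ , lt with to∈ s′
  ... | here refl = lt
  ... | there y∈  = ≤-<-trans (All.lookup t≤s y∈) lt
  t≤ : ∀ {y} → y ∈ˡ x ∷ xs ++ s → t ≤ y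
  t≤ (here refl) = <⇒≤ t<x
  t≤ (there y∈) with ∈-++⁻ xs y∈
  ... | inj₁ y∈xs = ≮⇒≥ λ y<t → avt (contains-231⁺ (refl ∷ refl ∷ from∈ y∈xs) y<t t<x)
  ... | inj₂ y∈s  = All.lookup t≤s y∈s

stack21-sortable⇒avoids : 𝒮 p21 xs ≡ oneTo n → Avoids p231 xs
stack21-sortable⇒avoids {xs} {n} eq con with contains-231⁻ con
... | b , c , a , s , a<b , b<c = <-asym a<b (allPairs-⊆ (oneTo-increasing n)
  (subst (b ∷ a ∷ [] ⊆_) eq (stack21-inverts (run p21 xs []) s b<c)))

avoids⇒stack21-sortable : xs ∈ Symₙ n → Avoids p231 xs → 𝒮 p21 xs ≡ oneTo n
avoids⇒stack21-sortable {xs} p av =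
  sorted-symₙ (stack21-sorts (run p21 xs []) [] av []) (𝒮-Symₙ p21 p)

-- The shape 12 ⊖ β

Layered : ℕ → ℕ → List ℕ → Set
Layered p q r = p < q × All (_< p) r × Avoids p231 r

layered? : ∀ p q r → Dec (Layered p q r)
layered? p q r = (p <? q) ×-dec All.all? (_<? p) r ×-dec avoids? p231 r

layered-≃ : b ∷ t ∷ r ≃ p ∷ q ∷ s → Layered b t r → Layered p q s
layered-≃ (((bt , _) ∷ R) ∷ _ ∷ iso) (b<t , small , av) =
  to bt b<t , below small R , av ∘ contains-231-≃ (≃-sym iso)
  where
  below : All (_< _) xs → Pointwise (SameOrder _ _) xs ys → All (_< _) ys
  below []            []            = []
  below (z<b ∷ small) ((_ , g) ∷ R) = to g z<b ∷ below small R

layered-max : Layered p q r → All (_< q) (p ∷ r)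
layered-max (p<q , small , _) = p<q ∷ All.map (λ z<p → <-trans z<p p<q) small

layered-hat-avoids : Layered p q r → Avoids p231 (q ∷ p ∷ r)
layered-hat-avoids lay@(_ , small , av) = avoids-231-max∷ (layered-max lay) (avoids-231-max∷ small av)

-- The tail itself serves as β: q and p are the two largest entries, and removing them in this order
-- leaves a permutation.
layered⇒skew : ∀ p q z zs → p ∷ q ∷ z ∷ zs ∈ Symₙ n → Layered p q (z ∷ zs) →
  ∃[ β ] β ∈ Sym⟨ p231 ⟩ × IsSkewSum (1 ∷ 2 ∷ []) β (p ∷ q ∷ z ∷ zs)
layered⇒skew {n} p q z zs perm lay@(p<q , small , av) with n | perm | ↭-length perm
... | suc (suc (suc m)) | perm | _ =
  z ∷ zs , ((suc m , s≤s z≤n , symₙ-drop-max small (symₙ-drop-max (layered-max lay)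
                                  (↭-trans (swap q p ↭-refl) perm))) , av)
  , (suc (suc (suc m)) , s≤s z≤n , perm)
  , p ∷ q ∷ [] , z ∷ zs , refl , <⇒≅12 p<q , ≃⇒≅ ≃-refl
  , λ { (here refl) y∈ → All.lookup small y∈
      ; (there (here refl)) y∈ → All.lookup (layered-max lay) (there y∈) }

skew⇒layered : Avoids p231 β → IsSkewSum (1 ∷ 2 ∷ []) β (p ∷ q ∷ r) → Layered p q r
skew⇒layered {β} av (_ , γ₁ , γ₂ , eq , iso₁ , iso₂ , above) with ≅12⇒< {γ₁} iso₁
... | _ , _ , refl , a<b with refl ← eq =
  a<b , All.tabulate (above (here refl)) , av ∘ contains-231-≃ (≅⇒≃ {γ₂} {β} iso₂)

reverse-prefix : ∀ (p q : ℕ) r → reverse (p ∷ q ∷ r) ≡ reverse r ++ q ∷ p ∷ []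
reverse-prefix p q r = reverse-++ (p ∷ q ∷ []) r

-- The reversal ends in q p and starts with the last entry of the nonempty tail, which is below p.
layered-reverse-ξ : ∀ p q z zs → Layered p q (z ∷ zs) → reverse (p ∷ q ∷ z ∷ zs) ∈ Containsξ
layered-reverse-ξ p q z zs (p<q , small , _)
  with reverse (z ∷ zs) | ↭-reverse (z ∷ zs) | reverse-prefix p q (z ∷ zs)
... | []    | perm | _  = contradiction (↭-length perm) λ ()
... | a ∷ u | perm | eq = a , u , q , p , [] , eq , All.lookup small (∈-resp-↭ perm (here refl)) , p<q

-- Reversal turns ξ into an occurrence b c a of 231 with b and c adjacent and a at the end.
hat⇒layered : ∀ p q r → Unique (p ∷ q ∷ r) → Avoids p231 (hat (p ∷ q ∷ r)) →
  reverse (p ∷ q ∷ r) ∈ Containsξ → Layered p q r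
hat⇒layered p q r uniq av (a , u , c , b , v , eq , a<b , b<c) = split (reverse v) rev
  where
  open ≡-Reasoning
  rev : p ∷ q ∷ r ≡ reverse v ++ b ∷ c ∷ reverse u ++ a ∷ []
  rev = begin
    p ∷ q ∷ r                                ≡⟨ reverse-involutive _ ⟨
    reverse (reverse (p ∷ q ∷ r))            ≡⟨ cong reverse eq ⟩
    reverse ((a ∷ u) ++ c ∷ b ∷ v)                ≡⟨ reverse-++ (a ∷ u) (c ∷ b ∷ v) ⟩
    reverse (c ∷ b ∷ v) ++ reverse (a ∷ u)        ≡⟨ cong₂ _++_ (reverse-prefix c b v) (unfold-reverse a u) ⟩
    (reverse v ++ b ∷ c ∷ []) ++ reverse u ++ a ∷ []  ≡⟨ ++-assoc (reverse v) (b ∷ c ∷ []) _ ⟩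
    reverse v ++ b ∷ c ∷ reverse u ++ a ∷ []      ∎
  ca : c ∷ a ∷ [] ⊆ c ∷ reverse u ++ a ∷ []
  ca = refl ∷ ++⁺ˡ (reverse u) ⊆-refl
  -- Interchanging the first two entries destroys the occurrence b c a of 231
  -- only if b and c are these entries.
  split : ∀ w → p ∷ q ∷ r ≡ w ++ b ∷ c ∷ reverse u ++ a ∷ [] → Layered p q r
  split (_ ∷ []) refl = ⊥-elim (av (contains-231⁺ (refl ∷ _ ∷ʳ ca) a<b b<c))
  split (_ ∷ _ ∷ w) eq′ = ⊥-elim (av (contains-231⁺
    (_ ∷ʳ _ ∷ʳ subst (_ ⊆_) (sym (∷-injectiveʳ (∷-injectiveʳ eq′))) (++⁺ˡ w (refl ∷ ca))) a<b b<c))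
  split [] refl = b<c , All.tabulate below , avoids-⊆ (_ ∷ʳ _ ∷ʳ ⊆-refl) av
    where
    below : ∀ {y} → y ∈ˡ reverse u ++ a ∷ [] → y < b
    below y∈ with ∈-++⁻ (reverse u) y∈
    ... | inj₂ (here refl) = a<b
    ... | inj₁ y∈u with <-cmp _ b
    ... | tri< y<b _ _ = y<b
    ... | tri≈ _ refl _ = contradiction refl (All.lookup (AllPairs.head uniq) (there y∈))
    -- Since a is the last entry, b y a would be an occurrence of 231.
    ... | tri> _ _ b<y = ⊥-elim (av (contains-231⁺ (_ ∷ʳ refl ∷ ++⁺ (from∈ y∈u) ⊆-refl) a<b b<y))

-- Sortable permutations and ξ

layered-𝒮 : ∀ p q z zs → 𝒮 (p ∷ q ∷ z ∷ zs) (reverse (p ∷ q ∷ z ∷ zs)) ≡ q ∷ p ∷ z ∷ zs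
layered-𝒮 p q z zs = run-unique (subst (λ π → Run pat π [] (q ∷ p ∷ z ∷ zs))
  (sym (reverse-prefix p q (z ∷ zs)))
  (run-load short (subst (λ s → Run pat (q ∷ p ∷ []) s (q ∷ p ∷ z ∷ zs)) (sym loaded) unload)))
  where
  pat : List ℕ
  pat = p ∷ q ∷ z ∷ zs
  short : length (reverse (z ∷ zs)) + 0 < length pat
  short = ≤-<-trans (≤-reflexive (trans (+-identityʳ _) (length-reverse (z ∷ zs)))) (n≤1+n _)
  loaded : reverse (z ∷ zs) ʳ++ [] ≡ z ∷ zs
  loaded = trans (ʳ++-defn (reverse (z ∷ zs))) (trans (++-identityʳ _) (reverse-involutive (z ∷ zs)))
  unload : Run pat (q ∷ p ∷ []) (z ∷ zs) (q ∷ p ∷ z ∷ zs)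
  -- The contents q r and p r are one entry shorter than the pattern, whereas p q r is the pattern
  -- itself.
  unload = push (avoids-short ≤-refl) (pop contains-self (push (avoids-short ≤-refl) done))

layered⇒Sort⊈Symξ : ∀ p q z zs → 1 ≤ n → p ∷ q ∷ z ∷ zs ∈ Symₙ n → Layered p q (z ∷ zs) →
  Sort (p ∷ q ∷ z ∷ zs) ⊈ Symξ
layered⇒Sort⊈Symξ {n} p q z zs n≥1 perm lay sub =
  proj₂ (sub (n , n≥1 , ↭-trans (↭-reverse _) perm , sorted)) (layered-reverse-ξ p q z zs lay)
  where
  sorted : 𝒮 p21 (𝒮 (p ∷ q ∷ z ∷ zs) (reverse (p ∷ q ∷ z ∷ zs))) ≡ oneTo n
  sorted = trans (cong (𝒮 p21) (layered-𝒮 p q z zs))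
    (avoids⇒stack21-sortable (↭-trans (swap q p ↭-refl) perm) (layered-hat-avoids lay))

module _ (p q z : ℕ) (zs : List ℕ) where
  private
    pat : List ℕ
    pat = p ∷ q ∷ z ∷ zs

  -- The pattern has at least three entries, so nothing can force out an entry that is alone on the
  -- stack.
  bottom-stays : ¬ Contains pat (x ∷ a ∷ [])
  bottom-stays = avoids-short (s≤s (s≤s z<s))

  -- t is the last entry popped before b is pushed, so that the occurrence of
  -- the pattern that forced the pop starts with b t.
  last-pop : ∀ s → a < b → b < c → Contains pat (b ∷ t ∷ s ++ a ∷ []) →
    t ≡ c ⊎ Avoids pat (c ∷ t ∷ s ++ a ∷ []) → Avoids pat (t ∷ s ++ a ∷ []) →
    Avoids pat (b ∷ s ++ a ∷ []) →
    b ∷ s ++ a ∷ [] ⊆ o → Unique (t ∷ o) → Avoids p231 o → Layered p q (z ∷ zs)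
  -- An occurrence without b lies in the old stack, and one without t lies in the stack onto which b
  -- is pushed; both avoid the pattern.
  last-pop _ a<b b<c (_ , _ ∷ʳ s′ , iso) _ avt _ _ _ _ = ⊥-elim (avt (_ , s′ , iso))
  last-pop _ a<b b<c (_ , refl ∷ _ ∷ʳ s′ , iso) _ _ avb _ _ _ = ⊥-elim (avb (_ , refl ∷ s′ , iso))
  last-pop {a} {b} {c} {t} {o} s a<b b<c (_ , refl ∷ refl ∷ r⊆ , iso) avc _ _ bs⊆o
    (t∉o ∷ o-unique) av231 = compare (<-cmp b t)
    where
    below : ∀ {y} → y ∈ˡ s ++ a ∷ [] → y < b
    below y∈ with ∈-++⁻ s y∈
    ... | inj₂ (here refl) = a<b
    ... | inj₁ y∈s with <-cmp _ b
    ... | tri< y<b _ _  = y<b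
    ... | tri≈ _ refl _ = contradiction refl
      (allPairs-⊆ o-unique (⊆-trans (refl ∷ from∈ y∈) bs⊆o))
    ... | tri> _ _ b<y  = ⊥-elim (av231 (contains-231⁺
      (⊆-trans (refl ∷ ++⁺ (from∈ y∈s) ⊆-refl) bs⊆o) a<b b<y))
    small = All-resp-⊆ r⊆ (All.tabulate below)
    compare : Tri (b < t) (b ≡ t) (t < b) → Layered p q (z ∷ zs)
    compare (tri< b<t _ _) =
      layered-≃ (≅⇒≃ iso) (b<t , small , avoids-⊆ (⊆-trans r⊆ (∷ˡ⁻ bs⊆o)) av231)
    compare (tri≈ _ refl _) = contradiction refl (All.lookup t∉o (to∈ bs⊆o))
    compare (tri> _ _ t<b) = ⊥-elim (exclude avc)
      where
      exclude : ¬ (t ≡ c ⊎ Avoids pat (c ∷ t ∷ s ++ a ∷ []))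
      exclude (inj₁ refl) = <-asym t<b b<c
      -- With t below b, the entry b is the maximum of the occurrence, so c can take its place.
      exclude (inj₂ av)   = av (_ , refl ∷ refl ∷ r⊆ ,
        ≃⇒≅ (raise-max (t<b ∷ small) b<c (≅⇒≃ iso)))

  -- The avoidance hypotheses all descend from the content with c on top, since pops only delete
  -- entries. The alternative `t ≡ c` covers the first pop, that of c itself; each further pop
  -- replaces t and the occurrence that forced it out.
  pop-until-push : ∀ s → a < b → b < c → Run pat (b ∷ v) (s ++ a ∷ []) o →
    Contains pat (b ∷ t ∷ s ++ a ∷ []) →
    t ≡ c ⊎ Avoids pat (c ∷ t ∷ s ++ a ∷ []) → Avoids pat (t ∷ s ++ a ∷ []) →
    Avoids pat (c ∷ s ++ a ∷ []) →
    Unique (t ∷ o) → Avoids p231 o → Layered p q (z ∷ zs)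
  pop-until-push []      a<b b<c (push av r) con avc avt _ uniq av231 =
    last-pop [] a<b b<c con avc avt av (run-⊇ r) uniq av231
  pop-until-push []      _   _   (pop con _) = ⊥-elim (bottom-stays con)
  pop-until-push (t ∷ s) a<b b<c (push av r) con avc avt _ uniq av231 =
    last-pop (t ∷ s) a<b b<c con avc avt av (run-⊇ r) uniq av231
  pop-until-push (t ∷ s) a<b b<c (pop con r) _ _ _ avc (_ ∷ uniq) av231 =
    pop-until-push s a<b b<c r con (inj₂ avc) (avoids-⊆ (_ ∷ʳ ⊆-refl) avc)
      (avoids-⊆ (refl ∷ _ ∷ʳ ⊆-refl) avc) uniq (avoids-⊆ (_ ∷ʳ ⊆-refl) av231)

  -- If c were not popped, the stack would end up containing b c a, and with it
  -- the output.
  descent-pops : ∀ s → a < b → b < c → Run pat (b ∷ v) (c ∷ s ++ a ∷ []) o →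
    Avoids pat (c ∷ s ++ a ∷ []) → Unique o → Avoids p231 o → Layered p q (z ∷ zs)
  descent-pops s a<b b<c (push _ r)  _   _    av231 = ⊥-elim (av231 (contains-231⁺
    (⊆-trans (refl ∷ refl ∷ ++⁺ˡ s ⊆-refl) (run-⊇ r)) a<b b<c))
  descent-pops s a<b b<c (pop con r) avc uniq av231 =
    pop-until-push s a<b b<c r con (inj₁ refl) avc avc uniq (avoids-⊆ (_ ∷ʳ ⊆-refl) av231)

  -- Induction on the run until c is pushed. Throughout, a is the bottom entry, and what is popped
  -- meanwhile is dropped from the output. The push of c certifies that the content with c on top
  -- avoids the pattern.
  ξ-forces-layered : ∀ u s → a < b → b < c → Run pat (u ++ c ∷ b ∷ v) (s ++ a ∷ []) o →
    Unique o → Avoids p231 o → Layered p q (z ∷ zs)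
  ξ-forces-layered []      []      a<b b<c (push av r)  uniq av231 =
    descent-pops [] a<b b<c r av uniq av231
  ξ-forces-layered []      []      _   _   (pop con _)  = ⊥-elim (bottom-stays con)
  ξ-forces-layered []      (t ∷ s) a<b b<c (push av r)  uniq av231 =
    descent-pops (t ∷ s) a<b b<c r av uniq av231
  ξ-forces-layered []      (_ ∷ s) a<b b<c (pop _ r) (_ ∷ uniq) av231 =
    ξ-forces-layered [] s a<b b<c r uniq (avoids-⊆ (_ ∷ʳ ⊆-refl) av231)
  ξ-forces-layered (x ∷ u) []      a<b b<c (push _ r)   = ξ-forces-layered u (x ∷ []) a<b b<c r
  ξ-forces-layered (_ ∷ _) []      _   _   (pop con _)  = ⊥-elim (bottom-stays con)
  ξ-forces-layered (x ∷ u) (t ∷ s) a<b b<c (push _ r)   = ξ-forces-layered u (x ∷ t ∷ s) a<b b<c r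
  ξ-forces-layered (x ∷ u) (_ ∷ s) a<b b<c (pop _ r) (_ ∷ uniq) av231 =
    ξ-forces-layered (x ∷ u) s a<b b<c r uniq (avoids-⊆ (_ ∷ʳ ⊆-refl) av231)

  sortable-ξ⇒layered : xs ∈ Sort pat → xs ∈ Containsξ → Layered p q (z ∷ zs)
  sortable-ξ⇒layered (_ , _ , perm , sorted) (a , u , c , b , v , refl , a<b , b<c)
    with start r ← run pat (a ∷ u ++ c ∷ b ∷ v) [] =
    ξ-forces-layered u [] a<b b<c r (symₙ-unique (𝒮-Symₙ pat perm)) (stack21-sortable⇒avoids sorted)

Sort⊈Symξ⇒layered : ∀ p q z zs → Sort (p ∷ q ∷ z ∷ zs) ⊈ Symξ → Layered p q (z ∷ zs)
-- A failed inclusion supplies no permutation, so the shape is obtained by contradiction, using its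
-- decidability.
Sort⊈Symξ⇒layered p q z zs ⊈ξ = decidable-stable (layered? p q (z ∷ zs)) λ ¬lay →
  ⊈ξ λ sort@(n , n≥1 , perm , _) → (n , n≥1 , perm) , λ con → ¬lay (sortable-ξ⇒layered p q z zs sort con)

-- Equivalence of the three conditions through the shape p q r

theorem6 : (k : ℕ) (σ : List ℕ) → k ≥ 3 → σ ∈ Symₙ k →
    let cond₁ = Sort σ ⊈ Symξ
        cond₂ = ∃[ β ] β ∈ Sym⟨ 2 ∷ 3 ∷ 1 ∷ [] ⟩ × IsSkewSum (1 ∷ 2 ∷ []) β σ
        cond₃ = hat σ ∈ Sym⟨ 2 ∷ 3 ∷ 1 ∷ [] ⟩ × reverse σ ∈ Containsξ
    in (cond₁ ⇔ cond₂) × (cond₂ ⇔ cond₃)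
theorem6 k@(suc (suc (suc _))) (p ∷ q ∷ z ∷ zs) (s≤s (s≤s (s≤s _))) perm =
  mk⇔ (λ c₁ → layered⇒skew p q z zs perm (Sort⊈Symξ⇒layered p q z zs c₁))
      (λ c₂ → layered⇒Sort⊈Symξ p q z zs (s≤s z≤n) perm (skew p q c₂)) ,
  mk⇔ (λ c₂ → ((k , s≤s z≤n , ↭-trans (swap q p ↭-refl) perm)
               , layered-hat-avoids (skew p q c₂)) , layered-reverse-ξ p q z zs (skew p q c₂))
      (λ ((_ , av) , con) → layered⇒skew p q z zs perm
        (hat⇒layered p q (z ∷ zs) (symₙ-unique perm) av con))
  where
  skew : ∀ p q {r} → ∃[ β ] β ∈ Sym⟨ p231 ⟩ × IsSkewSum (1 ∷ 2 ∷ []) β (p ∷ q ∷ r) → Layered p q r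
  skew _ _ (_ , (_ , av) , isSkew) = skew⇒layered av isSkew
theorem6 _ []           (s≤s (s≤s (s≤s _))) perm = contradiction (↭-length perm) λ ()
theorem6 _ (_ ∷ [])     (s≤s (s≤s (s≤s _))) perm = contradiction (↭-length perm) λ ()
theorem6 _ (_ ∷ _ ∷ []) (s≤s (s≤s (s≤s _))) perm = contradiction (↭-length perm) λ ()
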